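{- For any two integers $c$ and $p$ such that $c\geq 1$ and $0\leq p\leq c-1$, there exists a perfect graph $G$ with $\chi(G)=c$ and $\varphi(G)=p$. Similarly, for any two integers $c$ and $p$ such that $c\geq 2$ and $0\leq p\leq c-2$, there exists a perfect graph $G$ with $\chi(G)=c$ and $\hat{\varphi}(G)=p$.
   Context: All graphs are finite, simple and undirected, with at least one vertex. $\chi$ denotes the chromatic number. For a proper vertex coloring $r$ of $G$ and an induced subgraph $H$ of $G$, let $r(H)$ be the set of colors used by $r$ on the vertices of $H$. Define $\varphi_r(G)=\max_{H}\,(|r(H)|-\chi(H))$ over all induced subgraphs $H$ of $G$, and $\hat{\varphi}_r(G)$ as the same maximum taken only over all connected induced subgraphs $H$ of $G$. Define $\varphi(G)=\min_r \varphi_r(G)$ and $\hat{\varphi}(G)=\min_r \hat{\varphi}_r(G)$, the minima over all proper colorings $r$ of $G$ (with any number of colors). A graph is perfect if every induced subgraph has chromatic number equal to its clique number. -}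

module Defs where

open import Data.Fin using (Fin; _≟_)
open import Data.Fin.Properties using (any?)
open import Data.Fin.Subset using (Subset; _∈_; ∣_∣; Nonempty)
open import Data.Fin.Subset.Properties using (_∈?_)
open import Data.Nat using (ℕ; _≤_; _∸_)
open import Data.Product using (Σ; ∃-syntax; _×_; proj₁)
open import Data.Vec using (tabulate)
open import Level using (0ℓ)
open import Relation.Binary using (Rel; Decidable)
open import Relation.Binary.Construct.Closure.ReflexiveTransitive using (Star)
open import Relation.Binary.PropositionalEquality using (_≡_; _≢_)
open import Relation.Nullary using (¬_; does)
open import Relation.Nullary.Decidable using (_×-dec_)

IsMinimum IsMaximum : (ℕ → Set) → ℕ → Set
IsMinimum P m = P m × (∀ {k} → P k → m ≤ k)
IsMaximum P m = P m × (∀ {k} → P k → k ≤ m)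

-- Finiteness and nonemptiness are imposed through V: the graphs of interest
-- have V = Fin (suc n) or are induced on a nonempty subset of it.
record Graph (V : Set) : Set₁ where
  infix 4 _~_ _~?_
  field
    _~_    : Rel V 0ℓ
    _~?_   : Decidable _~_
    sym    : ∀ {u v} → u ~ v → v ~ u
    irrefl : ∀ {v} → ¬ (v ~ v)

record Colouring {V : Set} (G : Graph V) (k : ℕ) : Set where
  open Graph G
  field
    colour : V → Fin k
    proper : ∀ {u v} → u ~ v → colour u ≢ colour v

-- The k vertices are automatically distinct, as adjacency is irreflexive.
record Clique {V : Set} (G : Graph V) (k : ℕ) : Set where
  open Graph G
  field
    vertex   : Fin k → V
    adjacent : ∀ {i j} → i ≢ j → vertex i ~ vertex j

-- "χ(G) = k" and "ω(G) = k", stated as relations; k is determined by G.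
IsChromaticNumber IsCliqueNumber : {V : Set} → Graph V → ℕ → Set
IsChromaticNumber G = IsMinimum (Colouring G)
IsCliqueNumber    G = IsMaximum (Clique G)

Connected : {V : Set} → Graph V → Set
Connected {V} G = V × (∀ u v → Star (Graph._~_ G) u v)

infix 8 _[_]
_[_] : ∀ {n} → Graph (Fin n) → (S : Subset n) → Graph (∃[ v ] v ∈ S)
G [ S ] = record
  { _~_    = λ u v → proj₁ u ~ proj₁ v
  ; _~?_   = λ u v → proj₁ u ~? proj₁ v
  ; sym    = sym
  ; irrefl = irrefl
  }
  where open Graph G

Perfect : ∀ {n} → Graph (Fin n) → Set
Perfect G = ∀ S → Nonempty S →
  ∃[ k ] IsChromaticNumber (G [ S ]) k × IsCliqueNumber (G [ S ]) k

image : ∀ {n k} → (Fin n → Fin k) → Subset n → Subset k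
image f S = tabulate λ c → does (any? λ v → (v ∈? S) ×-dec (f v ≟ c))

module _ {n : ℕ} (G : Graph (Fin n)) where

  -- "d = |r(H)| − χ(H), where H is the subgraph induced on S". Truncated
  -- subtraction is exact: r restricted to H is proper, so χ(H) ≤ |r(H)|.
  IsExcess : ∀ {k} → Colouring G k → Subset n → ℕ → Set
  IsExcess r S d =
    ∃[ x ] IsChromaticNumber (G [ S ]) x × d ≡ ∣ image (Colouring.colour r) S ∣ ∸ x

  -- "φ_r(G) = m" and "φ̂_r(G) = m".
  Isφ[_] Isφ̂[_] : ∀ {k} → Colouring G k → ℕ → Set
  Isφ[ r ]  = IsMaximum λ d → ∃[ S ] Nonempty S × IsExcess r S d
  Isφ̂[ r ] = IsMaximum λ d → ∃[ S ] Connected (G [ S ]) × IsExcess r S d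

  -- "φ(G) = m" and "φ̂(G) = m"; the palette size k is unrestricted.
  Isφ Isφ̂ : ℕ → Set
  Isφ  = IsMinimum λ m → ∃[ k ] Σ (Colouring G k) λ r → Isφ[ r ] m
  Isφ̂ = IsMinimum λ m → ∃[ k ] Σ (Colouring G k) λ r → Isφ̂[ r ] m

{-# OPTIONS --safe #-}

-- Let G be the join of K_a with p + 1 disjoint copies ("blocks") of K_{p+1}, so
-- that χ(G) = a + p + 1. In any proper colouring one can pick greedily a vertex
-- from each block so that all p + 1 colours differ; these vertices are
-- independent, and together with a vertex of K_a (when a ≥ 1) they induce a
-- star. Either way the excess is p. Conversely, colour G optimally and let H be
-- induced: if H meets some block in B ≠ ∅, then H ∩ K_a together with B is a
-- clique that misses at most p of the colours used on H.
--
-- For a uniform vertex set Fin (a + p + 1) × Fin (p + 1) (colour, block), each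
-- vertex of K_a is replaced by p + 1 independent twins, which changes nothing
-- in the argument.
module Submission where

open import Data.Fin using (Fin; zero; suc; toℕ; fromℕ<; _≟_; _↑ʳ_; combine; remQuot)
open import Data.Fin.Properties using (any?; suc-injective; injective⇒≤; fromℕ<-injective;
  toℕ-fromℕ<; toℕ-↑ʳ; ↑ʳ-injective; splitAt-≥; splitAt⁻¹-↑ʳ; remQuot-combine)
open import Data.Fin.Subset using (Subset; inside; outside; _∈_; _⊆_; _∪_; _-_; ∣_∣; Nonempty)
open import Data.Fin.Subset.Properties using (_∈?_; p⊆q⇒∣p∣≤∣q∣; x∈p∪q⁺;
  x∈p∧x≢y⇒x∈p-y; x∈p⇒∣p-x∣<∣p∣)
open import Data.Nat using (ℕ; zero; suc; _+_; _*_; _∸_; _≤_; _<_; z≤n; s≤s; s≤s⁻¹; _<?_)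
open import Data.Nat.Properties using (≤-refl; ≤-trans; ≤-antisym; ≤-reflexive; ≤-total;
  <-≤-trans; <⇒≱; ≮⇒≥; m≤m+n; +-suc; +-monoˡ-≤; +-monoʳ-≤; ∸-mono; m≤n+o⇒m∸n≤o; m∸n+n≡m; n≤1+n)
  renaming (suc-injective to ℕ-suc-injective)
open import Data.Product using (Σ; ∃-syntax; _×_; _,_; proj₁; proj₂)
open import Data.Sum using (_⊎_; inj₁; inj₂)
import Data.Sum as Sum
open import Data.Vec using ([]; _∷_; tabulate; lookup; here; there)
open import Data.Vec.Properties using (lookup∘tabulate; lookup⇒[]=; []=⇒lookup)
open import Function using (_∘_; Injective; mk⇔)
open import Level using (0ℓ)
open import Relation.Binary.Construct.Closure.ReflexiveTransitive using (Star; ε; _◅_)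
open import Relation.Binary.PropositionalEquality
  using (_≡_; _≢_; refl; sym; trans; cong; subst; subst₂; module ≡-Reasoning)
open import Relation.Nullary using (¬_; Dec; does; yes; no; contradiction)
open import Relation.Nullary.Decidable using (_×-dec_; _⊎-dec_; ¬?; dec-true; does-⇔;
  decidable-stable)
open import Relation.Unary using (Pred; Decidable)
open import Defs

-- Finite subsets

subset : ∀ {n} {P : Pred (Fin n) 0ℓ} → Decidable P → Subset n
subset P? = tabulate (does ∘ P?)

module _ {n} {P : Pred (Fin n) 0ℓ} (P? : Decidable P) where

  ∈-subset⁺ : ∀ {x} → P x → x ∈ subset P?
  ∈-subset⁺ {x} px = lookup⇒[]= x _ (trans (lookup∘tabulate _ x) (dec-true (P? x) px))

  ∈-subset⁻ : ∀ {x} → x ∈ subset P? → P x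
  ∈-subset⁻ {x} x∈ with P? x | trans (sym (lookup∘tabulate (does ∘ P?) x)) ([]=⇒lookup x∈)
  ... | yes px | _  = px
  ... | no  _  | ()

∣p∪q∣≤∣p∣+∣q∣ : ∀ {n} (p q : Subset n) → ∣ p ∪ q ∣ ≤ ∣ p ∣ + ∣ q ∣
∣p∪q∣≤∣p∣+∣q∣ []            []            = z≤n
∣p∪q∣≤∣p∣+∣q∣ (outside ∷ p) (outside ∷ q) = ∣p∪q∣≤∣p∣+∣q∣ p q
∣p∪q∣≤∣p∣+∣q∣ (outside ∷ p) (inside  ∷ q) =
  ≤-trans (s≤s (∣p∪q∣≤∣p∣+∣q∣ p q)) (≤-reflexive (sym (+-suc ∣ p ∣ ∣ q ∣)))
∣p∪q∣≤∣p∣+∣q∣ (inside  ∷ p) (outside ∷ q) = s≤s (∣p∪q∣≤∣p∣+∣q∣ p q)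
∣p∪q∣≤∣p∣+∣q∣ (inside  ∷ p) (inside  ∷ q) =
  s≤s (≤-trans (∣p∪q∣≤∣p∣+∣q∣ p q) (+-monoʳ-≤ ∣ p ∣ (n≤1+n ∣ q ∣)))

nth : ∀ {n} (U : Subset n) → Fin ∣ U ∣ → Fin n
nth (outside ∷ U) i       = suc (nth U i)
nth (inside  ∷ U) zero    = zero
nth (inside  ∷ U) (suc i) = suc (nth U i)

nth-∈ : ∀ {n} (U : Subset n) i → nth U i ∈ U
nth-∈ (outside ∷ U) i       = there (nth-∈ U i)
nth-∈ (inside  ∷ U) zero    = here
nth-∈ (inside  ∷ U) (suc i) = there (nth-∈ U i)

nth-injective : ∀ {n} (U : Subset n) → Injective _≡_ _≡_ (nth U)
nth-injective (outside ∷ U) {i}     {j}     eq = nth-injective U (suc-injective eq)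
nth-injective (inside  ∷ U) {zero}  {zero}  eq = refl
nth-injective (inside  ∷ U) {suc i} {suc j} eq = cong suc (nth-injective U (suc-injective eq))

-- Counts the members of `U` below `x`, so ranks renumber the members without gaps. They become the
-- colours in optimal colourings of induced subgraphs.
rank : ∀ {n} → Subset n → Fin n → ℕ
rank (_       ∷ U) zero    = zero
rank (outside ∷ U) (suc x) = rank U x
rank (inside  ∷ U) (suc x) = suc (rank U x)

rank<∣U∣ : ∀ {n} {U : Subset n} {x} → x ∈ U → rank U x < ∣ U ∣
rank<∣U∣ {U = inside  ∷ U} {zero}  here       = s≤s z≤n
rank<∣U∣ {U = outside ∷ U} {suc x} (there x∈) = rank<∣U∣ x∈
rank<∣U∣ {U = inside  ∷ U} {suc x} (there x∈) = s≤s (rank<∣U∣ x∈)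

rank-injective : ∀ {n} {U : Subset n} {x y} → x ∈ U → y ∈ U → rank U x ≡ rank U y → x ≡ y
rank-injective {U = _       ∷ U} {zero}  {zero}  _          _          _  = refl
rank-injective {U = inside  ∷ U} {zero}  {suc y} _          _          ()
rank-injective {U = inside  ∷ U} {suc x} {suc y} (there x∈) (there y∈) eq =
  cong suc (rank-injective x∈ y∈ (ℕ-suc-injective eq))
rank-injective {U = outside ∷ U} {suc x} {suc y} (there x∈) (there y∈) eq =
  cong suc (rank-injective x∈ y∈ eq)

rank-local : ∀ {n} (U U′ : Subset n) x →
  (∀ y → toℕ y < toℕ x → lookup U y ≡ lookup U′ y) → rank U x ≡ rank U′ x
rank-local (_ ∷ U) (_ ∷ U′) zero    _     = refl
rank-local (s ∷ U) (t ∷ U′) (suc x) agree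
  with s | t | agree zero (s≤s z≤n) | rank-local U U′ x (λ y y<x → agree (suc y) (s≤s y<x))
... | outside | outside | _ | eq = eq
... | inside  | inside  | _ | eq = cong suc eq

injective⇒≤∣U∣ : ∀ {m n} {U : Subset n} {f : Fin m → Fin n} →
  Injective _≡_ _≡_ f → (∀ i → f i ∈ U) → m ≤ ∣ U ∣
injective⇒≤∣U∣ {f = f} f-inj f∈ = injective⇒≤ {f = λ i → fromℕ< (rank<∣U∣ (f∈ i))}
  λ eq → f-inj (rank-injective (f∈ _) (f∈ _) (fromℕ<-injective _ _ _ _ eq))

range? : ∀ {m n} (f : Fin m → Fin n) → Decidable (λ y → ∃[ i ] f i ≡ y)
range? f y = any? λ i → f i ≟ y

range : ∀ {m n} → (Fin m → Fin n) → Subset n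
range f = subset (range? f)

∈-range : ∀ {m n} (f : Fin m → Fin n) i → f i ∈ range f
∈-range f i = ∈-subset⁺ (range? f) (i , refl)

-- Choosing a preimage for each member of the range is injective, since `f` recovers the member.
∣range∣≤ : ∀ {m n} (f : Fin m → Fin n) → ∣ range f ∣ ≤ m
∣range∣≤ f = injective⇒≤ {f = proj₁ ∘ preimage} λ {i} {j} eq → nth-injective (range f)
  (trans (sym (proj₂ (preimage i))) (trans (cong f eq) (proj₂ (preimage j))))
  where
  preimage : ∀ i → ∃[ x ] f x ≡ nth (range f) i
  preimage i = ∈-subset⁻ (range? f) (nth-∈ (range f) i)

module _ {n k} (f : Fin n → Fin k) (S : Subset n) where

  -- Repeats the decision inside `image`, so that `image f S` is `subset image?` by definition.
  image? : Decidable (λ c → ∃[ v ] v ∈ S × f v ≡ c)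
  image? c = any? λ v → (v ∈? S) ×-dec (f v ≟ c)

  ∈-image⁺ : ∀ {v} → v ∈ S → f v ∈ image f S
  ∈-image⁺ v∈ = ∈-subset⁺ image? (_ , v∈ , refl)

  ∈-image⁻ : ∀ {c} → c ∈ image f S → ∃[ v ] v ∈ S × f v ≡ c
  ∈-image⁻ = ∈-subset⁻ image?

-- Maxima and greedy choice

argmax : ∀ {n} (f : Fin (suc n) → ℕ) → ∃[ i ] ∀ j → f j ≤ f i
argmax {zero}  f = zero , λ { zero → ≤-refl }
argmax {suc n} f with argmax (f ∘ suc)
... | i , max with ≤-total (f zero) (f (suc i))
...   | inj₁ f0≤ = suc i , λ { zero → f0≤ ; (suc j) → max j }
...   | inj₂ f0≥ = zero  , λ { zero → ≤-refl ; (suc j) → ≤-trans (max j) f0≥ }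

-- The rows after the first are served first; fewer than `n` values are then taken, and row zero has
-- `n` distinct ones to choose from.
transversal : ∀ {m n k} → m ≤ n → (f : Fin m → Fin n → Fin k) →
  (∀ j → Injective _≡_ _≡_ (f j)) → Σ (Fin m → Fin n) λ t → Injective _≡_ _≡_ (λ j → f j (t j))
transversal {zero}          _   f f-inj = (λ ()) , λ { {()} }
transversal {suc m} {n} {k} m<n f f-inj
  with transversal (≤-trans (n≤1+n m) m<n) (f ∘ suc) (f-inj ∘ suc)
... | t , t-inj = choose (any? λ i → ¬? (used? i))
  where
  Used : Fin n → Set
  Used i = ∃[ j ] f (suc j) (t j) ≡ f zero i

  used? : Decidable Used
  used? i = any? λ j → f (suc j) (t j) ≟ f zero i

  choose : Dec (∃[ i ] ¬ Used i) →
    Σ (Fin (suc m) → Fin n) λ t′ → Injective _≡_ _≡_ (λ j → f j (t′ j))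
  choose (yes (i , unused)) = t′ , λ {x} {y} → inj x y
    where
    t′ : Fin (suc m) → Fin n
    t′ zero    = i
    t′ (suc j) = t j

    inj : ∀ x y → f x (t′ x) ≡ f y (t′ y) → x ≡ y
    inj zero    zero    _  = refl
    inj zero    (suc y) eq = contradiction (y , sym eq) unused
    inj (suc x) zero    eq = contradiction (x , eq) unused
    inj (suc x) (suc y) eq = cong suc (t-inj eq)
  -- Were every value of row zero taken, sending each to a row that took it would inject `Fin n`
  -- into `Fin m`.
  choose (no all-used) = contradiction (injective⇒≤ owner-inj) (<⇒≱ m<n)
    where
    owner : ∀ i → Used i
    owner i = decidable-stable (used? i) λ unused → all-used (i , unused)

    owner-inj : Injective _≡_ _≡_ (proj₁ ∘ owner)
    owner-inj {x} {y} eq = f-inj zero (trans (sym (proj₂ (owner x)))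
      (trans (cong (λ j → f (suc j) (t j)) eq) (proj₂ (owner y))))

-- Colourings and cliques

clique≤colouring : ∀ {V} {G : Graph V} {k l} → Clique G k → Colouring G l → k ≤ l
clique≤colouring K r = injective⇒≤ λ {i} {j} eq →
  decidable-stable (i ≟ j) λ i≢j → Colouring.proper r (Clique.adjacent K i≢j) eq

clique∧colouring⇒χ : ∀ {V} {G : Graph V} {k} → Clique G k → Colouring G k → IsChromaticNumber G k
clique∧colouring⇒χ K r = r , clique≤colouring K

clique∧colouring⇒ω : ∀ {V} {G : Graph V} {k} → Clique G k → Colouring G k → IsCliqueNumber G k
clique∧colouring⇒ω K r = K , λ K′ → clique≤colouring K′ r

range-colouring : ∀ {m n l} (G : Graph (Fin n)) (g : Fin m → Fin n) (h : Fin m → Fin l) →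
  (∀ i j → Graph._~_ G (g i) (g j) → h i ≢ h j) → Colouring (G [ range g ]) l
range-colouring G g h h-proper = record
  { colour = λ (_ , v∈) → h (proj₁ (index v∈))
  ; proper = λ {(_ , u∈)} {(_ , v∈)} u~v → h-proper _ _
      (subst₂ (Graph._~_ G) (sym (proj₂ (index u∈))) (sym (proj₂ (index v∈))) u~v)
  }
  where
  index : ∀ {v} → v ∈ range g → ∃[ i ] g i ≡ v
  index = ∈-subset⁻ (range? g)

-- Hubs and blocks: the graph and its chromatic number

module _ (a p : ℕ) where

  private
    q = suc p
    c = a + q

  colourOf : Fin (c * q) → Fin c
  colourOf v = proj₁ (remQuot {c} q v)

  blockOf : Fin (c * q) → Fin q
  blockOf v = proj₂ (remQuot {c} q v)

  colourOf-combine : ∀ x b → colourOf (combine x b) ≡ x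
  colourOf-combine x b = cong proj₁ (remQuot-combine x b)

  blockOf-combine : ∀ (x : Fin c) b → blockOf (combine x b) ≡ b
  blockOf-combine x b = cong proj₂ (remQuot-combine {c} x b)

  -- A property of colours: the `q` twins of one vertex of K_a share its colour and differ in the
  -- block.
  Hub : Fin c → Set
  Hub x = toℕ x < a

  hub? : Decidable Hub
  hub? x = toℕ x <? a

  ¬hub-↑ʳ : ∀ i → ¬ Hub (a ↑ʳ i)
  ¬hub-↑ʳ i hub = <⇒≱ hub (≤-trans (m≤m+n a (toℕ i)) (≤-reflexive (sym (toℕ-↑ʳ a i))))

  nonHubs : Subset c
  nonHubs = range (a ↑ʳ_)

  ∈-nonHubs : ∀ {x} → ¬ Hub x → x ∈ nonHubs
  ∈-nonHubs {x} ¬hub = subst (_∈ nonHubs) (splitAt⁻¹-↑ʳ (splitAt-≥ a x (≮⇒≥ ¬hub)))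
    (∈-range (a ↑ʳ_) _)

  blocks : Graph (Fin (c * q))
  blocks = record
    { _~_    = λ u v → colourOf u ≢ colourOf v
                 × (blockOf u ≡ blockOf v ⊎ Hub (colourOf u) ⊎ Hub (colourOf v))
    ; _~?_   = λ u v → ¬? (colourOf u ≟ colourOf v)
                 ×-dec ((blockOf u ≟ blockOf v) ⊎-dec (hub? (colourOf u) ⊎-dec hub? (colourOf v)))
    ; sym    = λ (u≢v , e) → u≢v ∘ sym , Sum.map sym Sum.swap e
    ; irrefl = λ (v≢v , _) → v≢v refl
    }

  open Graph blocks using (_~_; irrefl)

  colouring : Colouring blocks c
  colouring = record { colour = colourOf ; proper = proj₁ }

  combine-~ : ∀ {x y} {b b′ : Fin q} → x ≢ y → b ≡ b′ ⊎ Hub x ⊎ Hub y → combine x b ~ combine y b′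
  combine-~ {x} {y} {b} {b′} x≢y e
    rewrite colourOf-combine x b | colourOf-combine y b′
          | blockOf-combine x b | blockOf-combine y b′ = x≢y , e

  combine-~⁻ : ∀ {x y} {b b′ : Fin q} → combine x b ~ combine y b′ →
    x ≢ y × (b ≡ b′ ⊎ Hub x ⊎ Hub y)
  combine-~⁻ {x} {y} {b} {b′} e
    rewrite colourOf-combine x b | colourOf-combine y b′
          | blockOf-combine x b | blockOf-combine y b′ = e

  χ-blocks : IsChromaticNumber blocks c
  χ-blocks = clique∧colouring⇒χ
    -- Block zero has a vertex of every colour.
    (record { vertex = λ x → combine x (zero {p}) ; adjacent = λ x≢y → combine-~ x≢y (inj₁ refl) })
    colouring

  -- Induced subgraphs: perfection and the upper bound on the excess

  module _ (S : Subset (c * q)) where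

    -- A hub colour counts for every block, whichever of its twins lies in `S`, because hubs are
    -- joined to all blocks.
    OnBlock : Fin q → Fin c → Set
    OnBlock b x = ∃[ v ] v ∈ S × colourOf v ≡ x × (blockOf v ≡ b ⊎ Hub x)

    onBlock? : ∀ b → Decidable (OnBlock b)
    onBlock? b x = any? λ v →
      (v ∈? S) ×-dec ((colourOf v ≟ x) ×-dec ((blockOf v ≟ b) ⊎-dec hub? x))

    blockColours : Fin q → Subset c
    blockColours b = subset (onBlock? b)

    ∈-blockColours : ∀ {v b} → v ∈ S → blockOf v ≡ b ⊎ Hub (colourOf v) →
      colourOf v ∈ blockColours b
    ∈-blockColours {b = b} v∈ e = ∈-subset⁺ (onBlock? b) (_ , v∈ , refl , e)

    -- One representative in `S` per colour: any two of them lie in block `b` together, or one is a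
    -- hub.
    blockClique : ∀ b → Clique (blocks [ S ]) ∣ blockColours b ∣
    blockClique b = record
      { vertex   = λ i → proj₁ (rep i) , proj₁ (proj₂ (rep i))
      ; adjacent = λ {i} {j} i≢j → adj (rep i) (rep j) (i≢j ∘ nth-injective (blockColours b))
      }
      where
      rep : ∀ i → OnBlock b (nth (blockColours b) i)
      rep i = ∈-subset⁻ (onBlock? b) (nth-∈ (blockColours b) i)

      adj : ∀ {x y} (u : OnBlock b x) (v : OnBlock b y) → x ≢ y → proj₁ u ~ proj₁ v
      adj (_ , _ , refl , inj₁ refl) (_ , _ , refl , inj₁ eq)  x≢y = x≢y , inj₁ (sym eq)
      adj (_ , _ , refl , inj₂ hub)  (_ , _ , refl , _)        x≢y = x≢y , inj₂ (inj₁ hub)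
      adj (_ , _ , refl , inj₁ _)    (_ , _ , refl , inj₂ hub) x≢y = x≢y , inj₂ (inj₂ hub)

    -- The hub colours come first, so their ranks are the same in all blocks.
    rank-hub : ∀ {x} b b′ → Hub x → rank (blockColours b) x ≡ rank (blockColours b′) x
    rank-hub {x} b b′ hub = rank-local (blockColours b) (blockColours b′) x λ y y<x →
      let move : ∀ {d d′} → OnBlock d y → OnBlock d′ y
          move (v , v∈ , eq , _) = v , v∈ , eq , inj₂ (≤-trans y<x (≤-trans (n≤1+n _) hub))
      in begin
        lookup (blockColours b) y   ≡⟨ lookup∘tabulate (does ∘ onBlock? b) y ⟩
        does (onBlock? b y)         ≡⟨ does-⇔ (mk⇔ move move) (onBlock? b y) (onBlock? b′ y) ⟩
        does (onBlock? b′ y)        ≡⟨ lookup∘tabulate (does ∘ onBlock? b′) y ⟨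
        lookup (blockColours b′) y  ∎
      where open ≡-Reasoning

    -- An optimal colouring of the subgraph induced on `S`: each block renumbers the colours it
    -- sees.
    vertexRank : Fin (c * q) → ℕ
    vertexRank v = rank (blockColours (blockOf v)) (colourOf v)

    -- Within one block, ranks separate colours. The rank of a hub may be taken in the block of the
    -- other end, which reduces to that case.
    vertexRank-≢ : ∀ {u v} → u ∈ S → v ∈ S → u ~ v → vertexRank u ≢ vertexRank v
    vertexRank-≢ {u} {v} u∈ v∈ (u≢v , e) eq with e
    ... | inj₁ same rewrite same = u≢v (rank-injective
            (∈-blockColours u∈ (inj₁ same)) (∈-blockColours v∈ (inj₁ refl)) eq)
    ... | inj₂ (inj₁ hub) = u≢v (rank-injective
            (∈-blockColours u∈ (inj₂ hub)) (∈-blockColours v∈ (inj₁ refl))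
            (trans (rank-hub (blockOf v) (blockOf u) hub) eq))
    ... | inj₂ (inj₂ hub) = u≢v (rank-injective
            (∈-blockColours u∈ (inj₁ refl)) (∈-blockColours v∈ (inj₂ hub))
            (trans eq (rank-hub (blockOf v) (blockOf u) hub)))

    -- A block that sees the most colours supplies the clique, and its number of colours exceeds
    -- every rank in use.
    clique×colouring : ∃[ k ] Clique (blocks [ S ]) k × Colouring (blocks [ S ]) k
    clique×colouring with argmax (λ b → ∣ blockColours b ∣)
    ... | b , max = _ , blockClique b , record
      { colour = λ (v , v∈) → fromℕ< (bound v∈)
      ; proper = λ {(_ , u∈)} {(_ , v∈)} u~v eq →
          vertexRank-≢ u∈ v∈ u~v (fromℕ<-injective _ _ (bound u∈) (bound v∈) eq)
      }
      where
      bound : ∀ {v} → v ∈ S → vertexRank v < ∣ blockColours b ∣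
      bound v∈ = <-≤-trans (rank<∣U∣ (∈-blockColours v∈ (inj₁ refl))) (max _)

    -- A block can miss only non-hub colours of `S`. If it contains a non-hub vertex of `S`, the
    -- colour `x` of that vertex is not missed, which leaves at most `p` of the `q` non-hub colours.
    image-cover : ∃[ b ] ∃[ x ] x ∈ nonHubs × image colourOf S ⊆ blockColours b ∪ (nonHubs - x)
    image-cover with any? (λ v → (v ∈? S) ×-dec ¬? (hub? (colourOf v)))
    ... | yes (w , w∈ , ¬hub) = blockOf w , colourOf w , ∈-nonHubs ¬hub , cover
      where
      cover : image colourOf S ⊆ blockColours (blockOf w) ∪ (nonHubs - colourOf w)
      cover x∈ with ∈-image⁻ colourOf S x∈
      ... | v , v∈ , refl with hub? (colourOf v) | colourOf v ≟ colourOf w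
      ...   | yes hub | _      = x∈p∪q⁺ (inj₁ (∈-blockColours v∈ (inj₂ hub)))
      ...   | no  _   | yes eq = x∈p∪q⁺ (inj₁ (subst (_∈ blockColours (blockOf w)) (sym eq)
                                                (∈-blockColours w∈ (inj₁ refl))))
      ...   | no ¬hub′ | no ≢w = x∈p∪q⁺ {p = blockColours (blockOf w)}
                                   (inj₂ (x∈p∧x≢y⇒x∈p-y (∈-nonHubs ¬hub′) ≢w))
    -- If `S` contains only hubs, every block sees all its colours; the block and the removed colour
    -- are arbitrary defaults.
    ... | no all-hubs = zero , a ↑ʳ zero , ∈-range (a ↑ʳ_) zero , cover
      where
      cover : image colourOf S ⊆ blockColours zero ∪ (nonHubs - (a ↑ʳ zero))
      cover x∈ with ∈-image⁻ colourOf S x∈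
      ... | v , v∈ , refl = x∈p∪q⁺ (inj₁ (∈-blockColours v∈ (inj₂
              (decidable-stable (hub? (colourOf v)) λ ¬hub → all-hubs (v , v∈ , ¬hub)))))

    image-bound : ∃[ b ] ∣ image colourOf S ∣ ≤ ∣ blockColours b ∣ + p
    image-bound with image-cover
    ... | b , x , x∈ , cover = b , ≤-trans (p⊆q⇒∣p∣≤∣q∣ cover)
      (≤-trans (∣p∪q∣≤∣p∣+∣q∣ (blockColours b) (nonHubs - x))
        (+-monoʳ-≤ _ (s≤s⁻¹ (<-≤-trans (x∈p⇒∣p-x∣<∣p∣ x∈) (∣range∣≤ (a ↑ʳ_))))))

    excess≤p : ∀ {d} → IsExcess blocks colouring S d → d ≤ p
    excess≤p (x , (r , _) , refl) with image-bound
    ... | b , bound = m≤n+o⇒m∸n≤o _ x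
      (≤-trans bound (+-monoˡ-≤ p (clique≤colouring (blockClique b) r)))

  perfect : Perfect blocks
  perfect S _ with clique×colouring S
  ... | k , K , r = k , clique∧colouring⇒χ K r , clique∧colouring⇒ω K r

  -- The lower bound on the excess for an arbitrary colouring

  range-excess : ∀ {k m l} (r : Colouring blocks k) (g : Fin m → Fin (c * q)) →
    Injective _≡_ _≡_ (Colouring.colour r ∘ g) → Colouring (blocks [ range g ]) l →
    ∃[ d ] IsExcess blocks r (range g) d × m ∸ l ≤ d
  -- `IsExcess` demands the exact chromatic number, which comes from here; `s` only caps it at `l`.
  range-excess r g rg-inj s with clique×colouring (range g)
  ... | x , K , t = _ , (x , clique∧colouring⇒χ K t , refl) ,
    ∸-mono (injective⇒≤∣U∣ rg-inj λ i → ∈-image⁺ (Colouring.colour r) (range g) (∈-range g i))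
           (clique≤colouring K s)

  leaf : (Fin q → Fin q) → Fin q → Fin (c * q)
  leaf t j = combine (a ↑ʳ t j) j

  leaf-≁ : ∀ t i j → ¬ (leaf t i ~ leaf t j)
  leaf-≁ t i j e with combine-~⁻ e
  ... | t≢ , inj₁ refl       = t≢ refl
  ... | _  , inj₂ (inj₁ hub) = ¬hub-↑ʳ _ hub
  ... | _  , inj₂ (inj₂ hub) = ¬hub-↑ʳ _ hub

  -- The `q` non-hub vertices of a block form a clique, so `r` gives them `q` different colours,
  -- enough for one greedy choice per block.
  rainbowLeaves : ∀ {k} (r : Colouring blocks k) →
    Σ (Fin q → Fin q) λ t → Injective _≡_ _≡_ (Colouring.colour r ∘ leaf t)
  rainbowLeaves r = transversal ≤-refl (λ j i → Colouring.colour r (combine (a ↑ʳ i) j))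
    λ j {x} {y} eq → decidable-stable (x ≟ y) λ x≢y →
      Colouring.proper r (combine-~ (x≢y ∘ ↑ʳ-injective a x y) (inj₁ refl)) eq

  -- `Q` stands for nonemptiness in the case of φ and for connectedness in the case of φ̂.
  LargeExcess : (Subset (c * q) → Set) → Set
  LargeExcess Q = ∀ {k} (r : Colouring blocks k) →
    ∃[ S ] Q S × ∃[ d ] IsExcess blocks r S d × p ≤ d

  largeExcess-nonempty : LargeExcess Nonempty
  largeExcess-nonempty r with rainbowLeaves r
  ... | t , inj = range (leaf t) , (_ , ∈-range (leaf t) zero) , range-excess r (leaf t) inj
    -- The leaves are independent, so one colour suffices and the excess is at least `q ∸ 1`, that
    -- is `p`.
    (range-colouring {l = 1} blocks (leaf t) (λ _ → zero) λ i j e → contradiction e (leaf-≁ t i j))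

  largeExcess-connected : 0 < a → LargeExcess (λ S → Connected (blocks [ S ]))
  largeExcess-connected 0<a r with rainbowLeaves r
  ... | t , inj = range star , (vertex zero , connected) ,
    range-excess r star (λ {i} {j} → star-rainbow i j)
    -- The centre adds one colour to the image and one to the bipartition: `suc q ∸ 2` is again `p`.
    (range-colouring {l = 2} blocks star side side-proper)
    where
    hub : Fin c
    hub = fromℕ< (≤-trans 0<a (m≤m+n a q))

    hub-Hub : Hub hub
    hub-Hub = subst (_< a) (sym (toℕ-fromℕ< _)) 0<a

    star : Fin (suc q) → Fin (c * q)
    star zero    = combine hub zero
    star (suc j) = leaf t j

    hub~leaf : ∀ j → star zero ~ star (suc j)
    hub~leaf j = combine-~ (λ eq → ¬hub-↑ʳ (t j) (subst Hub eq hub-Hub)) (inj₂ (inj₁ hub-Hub))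

    star-rainbow : ∀ i j → Colouring.colour r (star i) ≡ Colouring.colour r (star j) → i ≡ j
    star-rainbow zero    zero    _  = refl
    star-rainbow zero    (suc j) eq = contradiction eq (Colouring.proper r (hub~leaf j))
    star-rainbow (suc i) zero    eq = contradiction (sym eq) (Colouring.proper r (hub~leaf i))
    star-rainbow (suc i) (suc j) eq = cong suc (inj eq)

    side : Fin (suc q) → Fin 2
    side zero    = zero
    side (suc _) = suc zero

    side-proper : ∀ i j → star i ~ star j → side i ≢ side j
    side-proper zero    zero    e _ = irrefl {star zero} e
    side-proper (suc i) (suc j) e _ = leaf-≁ t i j e

    vertex : Fin (suc q) → ∃[ v ] v ∈ range star
    vertex i = star i , ∈-range star i

    connected : ∀ u v → Star (Graph._~_ (blocks [ range star ])) u v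
    connected (_ , u∈) (_ , v∈) with ∈-subset⁻ (range? star) u∈ | ∈-subset⁻ (range? star) v∈
    -- Both ends are the centre, but their membership proofs may differ, so the walk visits a leaf
    -- instead of being `ε`.
    ... | zero  , refl | zero  , refl =
      _◅_ {j = vertex (suc zero)} (hub~leaf zero) (Graph.sym blocks {star zero} (hub~leaf zero) ◅ ε)
    ... | zero  , refl | suc j , refl = hub~leaf j ◅ ε
    ... | suc i , refl | zero  , refl = Graph.sym blocks {star zero} (hub~leaf i) ◅ ε
    ... | suc i , refl | suc j , refl =
      _◅_ {j = vertex zero} (Graph.sym blocks {star zero} (hub~leaf i)) (hub~leaf j ◅ ε)

  -- The values of φ and φ̂

  minimum-p : (Q : Subset (c * q) → Set) → LargeExcess Q →
    IsMinimum (λ m → ∃[ k ] Σ (Colouring blocks k) λ r →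
      IsMaximum (λ d → ∃[ S ] Q S × IsExcess blocks r S d) m) p
  minimum-p Q large =
      -- For `colouring` itself, the lower bound from `large` meets the upper bound `excess≤p`.
      (c , colouring , attained , λ { (S , _ , excess) → excess≤p S excess })
    , λ { (_ , r , _ , upper) → let S , QS , _ , excess , p≤d = large r in
          ≤-trans p≤d (upper (S , QS , excess)) }
    where
    attained : ∃[ S ] Q S × IsExcess blocks colouring S p
    attained with large colouring
    ... | S , QS , d , excess , p≤d =
      S , QS , subst (IsExcess blocks colouring S) (≤-antisym (excess≤p S excess) p≤d) excess

-- The order `c * q` need not compute to a successor; a vertex shows that it is one.
nonzero-order : (P : ∀ {n} → Graph (Fin n) → Set) → ∀ {n} → Fin n → (G : Graph (Fin n)) → P G →
  ∃[ m ] Σ (Graph (Fin (suc m))) P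
nonzero-order P {suc m} _ G PG = m , G , PG

theorem5p4 : (∀ (c p : ℕ) → 1 ≤ c → p ≤ c ∸ 1 →
    ∃[ n ] Σ (Graph (Fin (suc n))) λ G →
    Perfect G × IsChromaticNumber G c × Isφ G p)
    ×
    (∀ (c p : ℕ) → 2 ≤ c → p ≤ c ∸ 2 →
    ∃[ n ] Σ (Graph (Fin (suc n))) λ G →
    Perfect G × IsChromaticNumber G c × Isφ̂ G p)
theorem5p4 = part₁ , part₂
  where
  split : ∀ {p m} → p ≤ m → m ∸ p + suc p ≡ suc m
  split {p} {m} p≤m = trans (+-suc (m ∸ p) p) (cong suc (m∸n+n≡m p≤m))

  part₁ : ∀ (c p : ℕ) → 1 ≤ c → p ≤ c ∸ 1 → ∃[ n ] Σ (Graph (Fin (suc n))) λ G →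
    Perfect G × IsChromaticNumber G c × Isφ G p
  part₁ (suc m) p _ p≤m = nonzero-order (λ G → Perfect G × IsChromaticNumber G (suc m) × Isφ G p)
    (combine (a ↑ʳ zero) (zero {p})) (blocks a p)
    (perfect a p , subst (IsChromaticNumber (blocks a p)) (split p≤m) (χ-blocks a p) ,
     minimum-p a p Nonempty (largeExcess-nonempty a p))
    -- The solution of a + p + 1 = c.
    where a = m ∸ p

  part₂ : ∀ (c p : ℕ) → 2 ≤ c → p ≤ c ∸ 2 → ∃[ n ] Σ (Graph (Fin (suc n))) λ G →
    Perfect G × IsChromaticNumber G c × Isφ̂ G p
  part₂ (suc (suc m)) p _ p≤m =
    nonzero-order (λ G → Perfect G × IsChromaticNumber G (suc (suc m)) × Isφ̂ G p)
    (combine (a ↑ʳ zero) (zero {p})) (blocks a p)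
    (perfect a p , subst (IsChromaticNumber (blocks a p)) (cong suc (split p≤m)) (χ-blocks a p) ,
     minimum-p a p _ (largeExcess-connected a p (s≤s z≤n)))
    -- The same equation, now with c at least p + 2, so that a hub exists to be the centre of the
    -- star.
    where a = suc (m ∸ p)
  part₂ (suc zero) p (s≤s ()) _
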